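{- The superport response matrix $L$ satisfies $$L=(D^{T}K^{ -1}D)^{ -1}.$$
   Context: Network. $G=(V,E)$ is a finite connected simple undirected graph; each edge $e$ has a conductance $c_e\in\mathbb R_{>0}$. The weighted Laplacian $L_c$ is the $V\times V$ matrix with $(L_c)_{uu}=\sum_{e\ni u}c_e$, $(L_c)_{uv}=-c_{uv}$ if $uv\in E$, and $0$ otherwise. Superports. The boundary $M\subseteq V$ is nonempty and partitioned into nonempty superports $M=A_1\sqcup\cdots\sqcup A_p$. Choose a root $r_a\in A_a$ for each $a$; $R=\{r_1,\dots,r_p\}$, $N=M\setminus R$, $q=|N|$, $N=(x_1,\dots,x_q)$ in a fixed order; $r(x)$ is the root of the superport containing $x$. Fix a ground root $g\in R$. $K=L_c[V\setminus\{g\},V\setminus\{g\}]$ is the Laplacian with the row and column of $g$ deleted. In $\mathbb R^{V\setminus\{g\}}$ with standard basis $(e_v)$ and the convention $e_g=0$, let $D$ be the matrix whose columns are $d_x=e_x-e_{r(x)}$, $x\in N$, in the fixed order. Superport response. Given $y\in\mathbb R^N$, consider voltages $U\in\mathbb R^V$ with $U_x-U_{r(x)}=y_x$ for all $x\in N$ whose incoming-current vector $\iota=L_cU$ satisfies $\iota_v=0$ for $v\notin M$ and $\sum_{v\in A_a}\iota_v=0$ for every $a$. Put $j_x=\iota_x$ for $x\in N$ (the independent incoming currents). The linear map $y\mapsto j$ is the superport response and $L$ is its $q\times q$ matrix in the chosen ordered root coordinates: $j=Ly$. -}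

module Defs where

open import Level using (Level; 0ℓ; _⊔_) renaming (suc to lsuc)
open import Algebra.Apartness.Bundles using (HeytingField; HeytingCommutativeRing)
open import Algebra.Bundles using (CommutativeRing)
import Algebra.Definitions.RawMonoid as RawMonoidDefinitions
open import Data.Fin.Base using (Fin; punchIn)
open import Data.Fin.Properties using (_≟_)
open import Data.Fin.Subset using (Subset; _∈_; Nonempty)
open import Data.Fin.Subset.Properties using (_∈?_)
open import Data.Nat.Base as ℕ using (ℕ; suc)
open import Data.Product.Base using (∃; _×_; _,_; proj₁; proj₂)
open import Data.Sum.Base using (_⊎_)
open import Data.Vec.Functional using (Vector)
open import Function.Base using (flip)
open import Function.Bundles using (_⇔_; module Equivalence)
open import Function.Definitions using (Injective)
open import Relation.Binary.Construct.Closure.ReflexiveTransitive using (Star)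
open import Relation.Binary.Core using (Rel)
open import Relation.Binary.Definitions using (Decidable; Irreflexive; Symmetric)
open import Relation.Binary.PropositionalEquality.Core using (_≡_; _≢_; refl)
open import Relation.Binary.Structures using (IsStrictPartialOrder)
open import Relation.Nullary.Decidable.Core using (yes; no)
open import Relation.Nullary.Negation.Core using (¬_)

-- A model of the real numbers: a Cauchy-complete Archimedean ordered field.
-- The axioms are the constructive ones (apartness instead of ≉, order not
-- assumed decidable); classically they characterise ℝ up to isomorphism.
record Reals c ℓ₁ ℓ₂ : Set (lsuc (c ⊔ ℓ₁ ⊔ ℓ₂)) where
  infix 4 _<_
  field
    heytingField : HeytingField c ℓ₁ ℓ₂

  open HeytingField heytingField public

  commutativeRing : CommutativeRing c ℓ₁
  commutativeRing = HeytingCommutativeRing.commutativeRing heytingCommutativeRing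

  open CommutativeRing commutativeRing public using (+-rawMonoid)
  open RawMonoidDefinitions +-rawMonoid public
    using (sum) renaming (_×_ to _·_)

  field
    _<_                  : Rel Carrier ℓ₂
    isStrictPartialOrder : IsStrictPartialOrder _≈_ _<_
    #⇔<⊎>                : ∀ {x y} → (x # y) ⇔ (x < y ⊎ y < x)
    +-monoʳ-<            : ∀ x {y z} → y < z → x + y < x + z
    *-pos                : ∀ {x y} → 0# < x → 0# < y → 0# < x * y
    archimedean          : ∀ x → ∃ λ n → x < n · 1#

  -- Exchanging i and j bounds the absolute value.
  Cauchy : (ℕ → Carrier) → Set (c ⊔ ℓ₂)
  Cauchy s = ∀ {ε} → 0# < ε →
    ∃ λ k → ∀ {i j} → k ℕ.≤ i → k ℕ.≤ j → s i - s j < ε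

  _ConvergesTo_ : (ℕ → Carrier) → Carrier → Set (c ⊔ ℓ₂)
  s ConvergesTo l = ∀ {ε} → 0# < ε →
    ∃ λ k → ∀ {i} → k ℕ.≤ i → s i - l < ε × l - s i < ε

  field
    complete : ∀ s → Cauchy s → ∃ λ l → s ConvergesTo l

record Graph (n : ℕ) : Set₁ where
  field
    Adj       : Rel (Fin n) 0ℓ
    adj?      : Decidable Adj
    symmetric : Symmetric Adj
    loopless  : Irreflexive _≡_ Adj

  Connected : Set
  Connected = ∀ u v → Star Adj u v

record Network {c ℓ₁ ℓ₂} (ℝ : Reals c ℓ₁ ℓ₂) (n : ℕ)
  : Set (lsuc 0ℓ ⊔ c ⊔ ℓ₁ ⊔ ℓ₂) where
  open Reals ℝ using (Carrier; _≈_; _<_; 0#)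
  field
    graph : Graph n

  open Graph graph public

  field
    connected       : Connected
    conductance     : ∀ {u v} → Adj u v → Carrier
    -- An edge is unordered, and two proofs of adjacency are the same edge:
    -- both are covered by leaving e and e′ unrelated.
    conductance-sym : ∀ {u v} (e : Adj u v) (e′ : Adj v u) →
                      conductance e ≈ conductance e′
    conductance-pos : ∀ {u v} (e : Adj u v) → 0# < conductance e

record Superports (n : ℕ) : Set where
  field
    M          : Subset n
    M-nonempty : Nonempty M
    p          : ℕ
    A          : Fin p → Subset n
    A-nonempty : ∀ a → Nonempty (A a)
    A-covers   : ∀ {v} → v ∈ M ⇔ ∃ λ a → v ∈ A a
    A-disjoint : ∀ {a b v} → v ∈ A a → v ∈ A b → a ≡ b

    root       : Fin p → Fin n
    root∈A     : ∀ a → root a ∈ A a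

    -- The list x₁,…,x_q of the elements of N = M ∖ R.
    q           : ℕ
    x           : Fin q → Fin n
    x-injective : Injective _≡_ _≡_ x
    x-lists-N   : ∀ {v} → (∃ λ i → x i ≡ v) ⇔ (v ∈ M × ∀ a → v ≢ root a)

    groundPort  : Fin p

  g : Fin n
  g = root groundPort

  x∈M : ∀ i → x i ∈ M
  x∈M i = proj₁ (Equivalence.to x-lists-N (i , refl))

  portOf : Fin q → Fin p
  portOf i = proj₁ (Equivalence.to A-covers (x∈M i))

  -- rootOf i is r(xᵢ).
  rootOf : Fin q → Fin n
  rootOf i = root (portOf i)

module Matrices {c ℓ₁ ℓ₂} (ℝ : Reals c ℓ₁ ℓ₂) where
  open Reals ℝ

  infixl 7 _⊗_ _⊛_
  infix  9 _ᵀ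
  infix  4 _≋_ _IsInverseOf_

  Matrix : ℕ → ℕ → Set c
  Matrix k l = Fin k → Fin l → Carrier

  _≋_ : ∀ {k l} → Matrix k l → Matrix k l → Set ℓ₁
  X ≋ Y = ∀ i j → X i j ≈ Y i j

  δ : ∀ {n} → Fin n → Fin n → Carrier
  δ i j with i ≟ j
  ... | yes _ = 1#
  ... | no  _ = 0#

  _⊗_ : ∀ {k l m} → Matrix k l → Matrix l m → Matrix k m
  (X ⊗ Y) i j = sum λ h → X i h * Y h j

  _⊛_ : ∀ {k l} → Matrix k l → Vector Carrier l → Vector Carrier k
  (X ⊛ v) i = sum λ h → X i h * v h

  _ᵀ : ∀ {k l} → Matrix k l → Matrix l k
  X ᵀ = flip X

  _IsInverseOf_ : ∀ {k} → Matrix k k → Matrix k k → Set ℓ₁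
  Y IsInverseOf X = (X ⊗ Y) ≋ δ × (Y ⊗ X) ≋ δ

  restrict : ∀ {n} → Subset n → Vector Carrier n → Vector Carrier n
  restrict S f v with v ∈? S
  ... | yes _ = f v
  ... | no  _ = 0#

  sumOver : ∀ {n} → Subset n → Vector Carrier n → Carrier
  sumOver S f = sum (restrict S f)

module _ {c ℓ₁ ℓ₂} {ℝ : Reals c ℓ₁ ℓ₂} where
  open Reals ℝ
  open Matrices ℝ

  module _ {n} (G : Network ℝ n) where
    open Network G

    weight : Fin n → Fin n → Carrier
    weight u v with adj? u v
    ... | yes e = conductance e
    ... | no  _ = 0#

    -- sum (weight u) is the sum over the edges at u: non-neighbours of u, and
    -- u itself, have weight 0.
    laplacian : Matrix n n
    laplacian u v with u ≟ v
    ... | yes _ = sum (weight u)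
    ... | no  _ = - weight u v

  module _ {m} (G : Network ℝ (suc m)) (P : Superports (suc m)) where
    open Superports P

    -- V ∖ {g} is indexed by Fin m through punchIn g : Fin m → Fin (suc m).
    K : Matrix m m
    K i j = laplacian G (punchIn g i) (punchIn g j)

    -- Gives the zero vector at v = g, since punchIn g never hits g.
    basis : Fin (suc m) → Vector Carrier m
    basis v i = δ (punchIn g i) v

    D : Matrix m q
    D i k = basis (x k) i - basis (rootOf k) i

    incomingCurrent : Vector Carrier (suc m) → Vector Carrier (suc m)
    incomingCurrent U = laplacian G ⊛ U

    record Admissible (y : Vector Carrier q) (U : Vector Carrier (suc m))
      : Set ℓ₁ where
      field
        portVoltage     : ∀ k → U (x k) - U (rootOf k) ≈ y k
        interiorCurrent : ∀ v → ¬ (v ∈ M) → incomingCurrent U v ≈ 0#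
        portCurrent     : ∀ a → sumOver (A a) (incomingCurrent U) ≈ 0#

    -- L is the matrix of the map y ↦ j: every y is realised by some
    -- voltages, and all voltages realising y induce j = L y.
    IsResponseMatrix : Matrix q q → Set (c ⊔ ℓ₁)
    IsResponseMatrix L = ∀ y →
      ∃ (Admissible y) ×
      (∀ U → Admissible y U → ∀ k → incomingCurrent U (x k) ≈ (L ⊛ y) k)

{-# OPTIONS --safe #-}
module Submission where

-- Call a matrix X positive definite if 0 < v · Xv for every v with an entry
-- apart from 0.  Elimination works constructively for such matrices: the
-- pivot is positive, hence invertible, and the Schur complement is again
-- positive definite.  K is positive definite: twice its quadratic form is the
-- sum of c_uv (U_u − U_v)² over ordered pairs, where U extends v by 0 at g, and
-- a path from g to a vertex where U is apart from 0 contains, by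
-- cotransitivity, an edge across which U changes.  Hence so are K⁻¹ and
-- DᵀK⁻¹D, since the rows of D in N form an identity matrix.  The superport
-- conditions determine the current at a root from the currents at N, so the
-- incoming current is Dj off g; thus the voltages relative to g are K⁻¹Dj, and
-- y = DᵀK⁻¹Dj.

open import Defs
open import Algebra.Bundles using (CommutativeRing)
import Algebra.Apartness.Properties.HeytingCommutativeRing as HeytingProperties
import Algebra.Properties.Ring as RingProperties
import Algebra.Properties.Semiring.Sum as SumProperties
open import Data.Fin.Base using (Fin; zero; suc; punchIn; punchOut)
open import Data.Fin.Properties
  using (_≟_; any?; punchIn-injective; punchInᵢ≢i; punchIn-punchOut)
open import Data.Fin.Subset using (Subset; _∈_)
open import Data.Fin.Subset.Properties using (_∈?_)
open import Data.Nat.Base using (ℕ; suc)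
open import Data.Product.Base using (∃; ∃₂; _×_; _,_; proj₁; proj₂)
open import Data.Sum.Base as Sum using (_⊎_; inj₁; inj₂)
open import Data.Vec.Functional using (Vector; _∷_; removeAt)
open import Function.Base using (_∘_)
open import Function.Bundles using (module Equivalence)
open import Level using (_⊔_)
open import Relation.Binary.Construct.Closure.ReflexiveTransitive using (Star; ε; _◅_)
open import Relation.Binary.PropositionalEquality as ≡ using (_≡_; _≢_)
import Relation.Binary.Reasoning.Setoid as ≈-Reasoning
open import Relation.Binary.Structures using (IsStrictPartialOrder)
open import Relation.Nullary.Decidable.Core using (yes; no)
open import Relation.Nullary.Negation.Core using (¬_; contradiction)

-- Order and apartness in a constructive ordered field

module OrderedField {c ℓ₁ ℓ₂} (ℝ : Reals c ℓ₁ ℓ₂) where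
  open Reals ℝ hiding (zero)
  open CommutativeRing commutativeRing using (ring)
  open RingProperties ring
  open HeytingProperties heytingCommutativeRing
  open ≈-Reasoning setoid
  open IsStrictPartialOrder isStrictPartialOrder public
    using (<-respˡ-≈; <-respʳ-≈)
    renaming (irrefl to <-irrefl; trans to <-trans; asym to <-asym)

  -x+[x+y]≈y : ∀ x y → - x + (x + y) ≈ y
  -x+[x+y]≈y x y = begin
    - x + (x + y)  ≈⟨ +-assoc (- x) x y ⟨
    - x + x + y    ≈⟨ +-congʳ (-‿inverseˡ x) ⟩
    0# + y         ≈⟨ +-identityˡ y ⟩
    y              ∎

  [x-z]-[y-z]≈x-y : ∀ x y z → x - z - (y - z) ≈ x - y
  [x-z]-[y-z]≈x-y x y z = begin
    x - z - (y - z)      ≈⟨ +-congˡ (⁻¹-anti-homo‿- y z) ⟩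
    x - z + (z - y)      ≈⟨ +-assoc _ _ _ ⟩
    x + (- z + (z - y))  ≈⟨ +-congˡ (-x+[x+y]≈y z (- y)) ⟩
    x - y                ∎

  <⇒# : ∀ {x y} → x < y → x # y
  <⇒# = Equivalence.from #⇔<⊎> ∘ inj₁

  >⇒# : ∀ {x y} → y < x → x # y
  >⇒# = Equivalence.from #⇔<⊎> ∘ inj₂

  -- The order is not decidable, so this comparison replaces trichotomy. It comes from
  -- cotransitivity of apartness: the unwanted sign in either branch is repaired by transitivity
  -- with `x < y`.
  <-cotrans : ∀ {x y} → x < y → ∀ z → x < z ⊎ z < y
  <-cotrans x<y z with #-cotrans (<⇒# x<y) z
  ... | inj₁ x#z = Sum.map₂ (λ z<x → <-trans z<x x<y) (Equivalence.to #⇔<⊎> x#z)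
  ... | inj₂ z#y = Sum.swap (Sum.map₂ (<-trans x<y) (Equivalence.to #⇔<⊎> z#y))

  +-cancelˡ-< : ∀ x {y z} → x + y < x + z → y < z
  +-cancelˡ-< x {y} {z} xy<xz =
    <-respʳ-≈ (-x+[x+y]≈y x z) (<-respˡ-≈ (-x+[x+y]≈y x y) (+-monoʳ-< (- x) xy<xz))

  neg⇒-‿pos : ∀ {x} → x < 0# → 0# < - x
  neg⇒-‿pos {x} x<0 =
    <-respʳ-≈ (+-identityʳ (- x)) (<-respˡ-≈ (-‿inverseˡ x) (+-monoʳ-< (- x) x<0))

  -- Nonnegativity is written `¬ (y < 0#)` throughout. Comparing `x + y` with the interval from `0#`
  -- to `x` leaves only a positive sum, since `x + y < x` would make `y` negative.
  +-pos-nonneg : ∀ {x y} → 0# < x → ¬ (y < 0#) → 0# < x + y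
  +-pos-nonneg {x} {y} 0<x y≮0 with <-cotrans 0<x (x + y)
  ... | inj₁ 0<x+y = 0<x+y
  ... | inj₂ x+y<x =
    contradiction (+-cancelˡ-< x (<-respʳ-≈ (sym (+-identityʳ x)) x+y<x)) y≮0

  +-nonneg : ∀ {x y} → ¬ (x < 0#) → ¬ (y < 0#) → ¬ (x + y < 0#)
  +-nonneg {x} {y} x≮0 y≮0 x+y<0 with <-cotrans x+y<0 x
  ... | inj₁ x+y<x = y≮0 (+-cancelˡ-< x (<-respʳ-≈ (sym (+-identityʳ x)) x+y<x))
  ... | inj₂ x<0   = x≮0 x<0

  -- This cancels the factor two in `energy+energy` without dividing.
  x+x-pos⇒x-pos : ∀ {x} → 0# < x + x → 0# < x
  x+x-pos⇒x-pos {x} 0<x+x with <-cotrans 0<x+x x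
  ... | inj₁ 0<x   = 0<x
  ... | inj₂ x<x+x = +-cancelˡ-< x (<-respˡ-≈ (sym (+-identityʳ x)) x<x+x)

  -- Apartness of two elements amounts to invertibility of their difference, so it depends on that
  -- difference alone.
  #-resp-- : ∀ {x y z w} → x - y ≈ z - w → x # y → z # w
  #-resp-- {x} {y} {z} {w} eq x#y with #⇒invertible x#y
  ... | d , d[x-y]≈1 , _ = invertibleˡ⇒# (d , trans (*-congˡ (sym eq)) d[x-y]≈1)

  #⇒-#0 : ∀ {x y} → x # y → x - y # 0#
  #⇒-#0 {x} {y} = #-resp-- (sym (x-0≈x (x - y)))

  -- Cotransitivity at the point `y`: either `y` is apart from `0#`, or `x + y` is apart from `y`,
  -- and that difference is `x`.
  +-#0 : ∀ {x y} → x + y # 0# → x # 0# ⊎ y # 0#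
  +-#0 {x} {y} x+y#0 = Sum.map₁ (#-resp-- x+y-y≈x-0) (#-cotrans x+y#0 y)
    where
    x+y-y≈x-0 : x + y - y ≈ x - 0#
    x+y-y≈x-0 = begin
      x + y - y    ≈⟨ +-assoc x y (- y) ⟩
      x + (y - y)  ≈⟨ +-congˡ (-‿inverseʳ y) ⟩
      x + 0#       ≈⟨ +-congˡ -0#≈0# ⟨
      x - 0#       ∎

  -- If `d` inverts the product, then `d * x` inverts `y`.
  *-#0ʳ : ∀ {x y} → x * y # 0# → y # 0#
  *-#0ʳ {x} {y} xy#0 with #⇒invertible xy#0
  ... | d , d[xy-0]≈1 , _ = invertibleˡ⇒# (d * x , (begin
    d * x * (y - 0#)  ≈⟨ *-congˡ (x-0≈x y) ⟩
    d * x * y         ≈⟨ *-assoc d x y ⟩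
    d * (x * y)       ≈⟨ *-congˡ (x-0≈x (x * y)) ⟨
    d * (x * y - 0#)  ≈⟨ d[xy-0]≈1 ⟩
    1#                ∎))

  -x*-y≈x*y : ∀ x y → - x * - y ≈ x * y
  -x*-y≈x*y x y = begin
    - x * - y      ≈⟨ -‿distribˡ-* x (- y) ⟨
    - (x * - y)    ≈⟨ -‿cong (-‿distribʳ-* x y) ⟨
    - - (x * y)    ≈⟨ -‿involutive (x * y) ⟩
    x * y          ∎

  square-pos : ∀ {x} → x # 0# → 0# < x * x
  square-pos {x} x#0 with Equivalence.to #⇔<⊎> x#0
  ... | inj₁ x<0 =
    <-respʳ-≈ (-x*-y≈x*y x x) (*-pos (neg⇒-‿pos x<0) (neg⇒-‿pos x<0))
  ... | inj₂ 0<x = *-pos 0<x 0<x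

  square-nonneg : ∀ x → ¬ (x * x < 0#)
  -- A negative square is apart from `0#`, so `x` is too, and then the square is positive.
  square-nonneg x x²<0 = <-asym x²<0 (square-pos (*-#0ʳ (<⇒# x²<0)))

  *-nonneg : ∀ {x y} → ¬ (x < 0#) → ¬ (y < 0#) → ¬ (x * y < 0#)
  *-nonneg {x} {y} x≮0 y≮0 xy<0
    with Equivalence.to #⇔<⊎> (*-#0ʳ (<⇒# xy<0))
       | Equivalence.to #⇔<⊎> (*-#0ʳ (<⇒# (<-respˡ-≈ (*-comm x y) xy<0)))
  ... | inj₁ y<0 | _        = y≮0 y<0
  ... | inj₂ _   | inj₁ x<0 = x≮0 x<0
  ... | inj₂ 0<y | inj₂ 0<x = <-asym xy<0 (*-pos 0<x 0<y)

-- Sums, vectors and matrices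

module LinearAlgebra {c ℓ₁ ℓ₂} (ℝ : Reals c ℓ₁ ℓ₂) where
  open Reals ℝ hiding (zero)
  open Matrices ℝ
  open CommutativeRing commutativeRing using (ring; semiring)
  open RingProperties ring
  open SumProperties semiring
    using (sum-cong-≋; sum-replicate-zero; sum-remove; ∑-distrib-+; ∑-comm;
           *-distribˡ-sum; *-distribʳ-sum)
  open HeytingProperties heytingCommutativeRing
  open OrderedField ℝ
  open ≈-Reasoning setoid

  infixl 7 _∙_

  _∙_ : ∀ {n} → Vector Carrier n → Vector Carrier n → Carrier
  v ∙ w = sum λ i → v i * w i

  Nonzero : ∀ {n} → Vector Carrier n → Set ℓ₂
  Nonzero v = ∃ λ i → v i # 0#

  PositiveDefinite : ∀ {n} → Matrix n n → Set (c ⊔ ℓ₂)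
  PositiveDefinite X = ∀ v → Nonzero v → 0# < v ∙ (X ⊛ v)

  sum-0 : ∀ {n} {f : Vector Carrier n} → (∀ i → f i ≈ 0#) → sum f ≈ 0#
  sum-0 {n} f≈0 = trans (sum-cong-≋ f≈0) (sum-replicate-zero n)

  sum-single : ∀ {n} {f : Vector Carrier n} i → (∀ j → j ≢ i → f j ≈ 0#) → sum f ≈ f i
  sum-single {suc n} {f} i f≈0 = begin
    sum f                        ≈⟨ sum-remove f ⟩
    f i + sum (removeAt f i)     ≈⟨ +-congˡ (sum-0 λ j → f≈0 (punchIn i j) (punchInᵢ≢i i j)) ⟩
    f i + 0#                     ≈⟨ +-identityʳ (f i) ⟩
    f i                          ∎

  -- Cancels the common remainder of the two sums. It recovers a current at a root from its
  -- superport, and the current at the ground from the whole network.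
  sum-determines : ∀ {n} {f h : Vector Carrier n} i → (∀ j → j ≢ i → f j ≈ h j) →
                   sum f ≈ sum h → f i ≈ h i
  sum-determines {suc n} {f} {h} i f≈h ∑f≈∑h =
    +-cancelʳ (sum (removeAt f i)) (f i) (h i) (begin
      f i + sum (removeAt f i)  ≈⟨ sum-remove f ⟨
      sum f                     ≈⟨ ∑f≈∑h ⟩
      sum h                     ≈⟨ sum-remove h ⟩
      h i + sum (removeAt h i)  ≈⟨ +-congˡ (sum-cong-≋ λ j → f≈h (punchIn i j) (punchInᵢ≢i i j)) ⟨
      h i + sum (removeAt f i)  ∎)

  sum-nonneg : ∀ {n} {f : Vector Carrier n} → (∀ i → ¬ (f i < 0#)) → ¬ (sum f < 0#)
  sum-nonneg {0}     f≮0 = <-irrefl refl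
  sum-nonneg {suc n} f≮0 = +-nonneg (f≮0 zero) (sum-nonneg (f≮0 ∘ suc))

  sum-pos : ∀ {n} {f : Vector Carrier n} → (∀ i → ¬ (f i < 0#)) → ∀ i → 0# < f i → 0# < sum f
  sum-pos {suc n} {f} f≮0 i 0<fi =
    <-respʳ-≈ (sym (sum-remove f)) (+-pos-nonneg 0<fi (sum-nonneg (f≮0 ∘ punchIn i)))

  sum-#0 : ∀ {n} {f : Vector Carrier n} → sum f # 0# → Nonzero f
  sum-#0 {0}     0#0 = contradiction 0#0 (#-irrefl refl)
  sum-#0 {suc n} ∑f#0 with +-#0 ∑f#0
  ... | inj₁ f₀#0 = zero , f₀#0
  ... | inj₂ ∑f′#0 with sum-#0 ∑f′#0
  ...   | i , fi#0 = suc i , fi#0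

  δ-≡ : ∀ {n} {i j : Fin n} → i ≡ j → δ i j ≈ 1#
  δ-≡ {i = i} {j} i≡j with i ≟ j
  ... | yes _   = refl
  ... | no  i≢j = contradiction i≡j i≢j

  δ-≢ : ∀ {n} {i j : Fin n} → i ≢ j → δ i j ≈ 0#
  δ-≢ {i = i} {j} i≢j with i ≟ j
  ... | yes i≡j = contradiction i≡j i≢j
  ... | no  _   = refl

  δ-sym : ∀ {n} (i j : Fin n) → δ i j ≈ δ j i
  δ-sym i j with i ≟ j
  ... | yes i≡j = sym (δ-≡ (≡.sym i≡j))
  ... | no  i≢j = sym (δ-≢ (i≢j ∘ ≡.sym))

  -- The map `f` lists indices, and `unique` is its injectivity at `w` only. One form thus serves
  -- the identity, `punchIn g` and the list `x`.
  sum-δ : ∀ {k l} (f : Fin k → Fin l) {w} {i} (h : Vector Carrier k) →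
          (∀ {j} → f j ≡ w → j ≡ i) → f i ≡ w → sum (λ j → δ w (f j) * h j) ≈ h i
  sum-δ f {w} {i} h unique fi≡w = begin
    sum (λ j → δ w (f j) * h j)  ≈⟨ sum-single i (λ j j≢i →
                                      trans (*-congʳ (δ-≢ (j≢i ∘ unique ∘ ≡.sym))) (zeroˡ (h j))) ⟩
    δ w (f i) * h i              ≈⟨ *-congʳ (δ-≡ (≡.sym fi≡w)) ⟩
    1# * h i                     ≈⟨ *-identityˡ (h i) ⟩
    h i                          ∎

  sum-δ-∉ : ∀ {k l} (f : Fin k → Fin l) {w} (h : Vector Carrier k) →
            (∀ j → w ≢ f j) → sum (λ j → δ w (f j) * h j) ≈ 0#
  sum-δ-∉ f h w∉f = sum-0 λ j → trans (*-congʳ (δ-≢ (w∉f j))) (zeroˡ (h j))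

  ∙-cong : ∀ {n} {v v′ w w′ : Vector Carrier n} →
           (∀ i → v i ≈ v′ i) → (∀ i → w i ≈ w′ i) → v ∙ w ≈ v′ ∙ w′
  ∙-cong v≈v′ w≈w′ = sum-cong-≋ λ i → *-cong (v≈v′ i) (w≈w′ i)

  ∙-comm : ∀ {n} (v w : Vector Carrier n) → v ∙ w ≈ w ∙ v
  ∙-comm v w = sum-cong-≋ λ i → *-comm (v i) (w i)

  ∙-minusˡ : ∀ {n} (v v′ w : Vector Carrier n) → (λ i → v i - v′ i) ∙ w ≈ v ∙ w - v′ ∙ w
  ∙-minusˡ {n} v v′ w = begin
    sum (λ i → (v i - v′ i) * w i)             ≈⟨ sum-cong-≋ (λ i → distribʳ (w i) (v i) (- v′ i)) ⟩
    sum (λ i → v i * w i + - v′ i * w i)       ≈⟨ ∑-distrib-+ {n} _ _ ⟩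
    v ∙ w + sum (λ i → - v′ i * w i)           ≈⟨ +-congˡ (sum-cong-≋ λ i →
                                                    trans (*-congʳ (sym (-1*x≈-x (v′ i)))) (*-assoc _ _ _)) ⟩
    v ∙ w + sum (λ i → - 1# * (v′ i * w i))    ≈⟨ +-congˡ (*-distribˡ-sum {n} (- 1#) _) ⟨
    v ∙ w + - 1# * (v′ ∙ w)                    ≈⟨ +-congˡ (-1*x≈-x (v′ ∙ w)) ⟩
    v ∙ w - v′ ∙ w                             ∎

  ⊛-cong : ∀ {k l} {X Y : Matrix k l} {v w : Vector Carrier l} →
           X ≋ Y → (∀ i → v i ≈ w i) → ∀ i → (X ⊛ v) i ≈ (Y ⊛ w) i
  ⊛-cong X≋Y v≈w i = ∙-cong (X≋Y i) v≈w

  ⊛-congˡ : ∀ {k l} (X : Matrix k l) {v w : Vector Carrier l} →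
            (∀ i → v i ≈ w i) → ∀ i → (X ⊛ v) i ≈ (X ⊛ w) i
  ⊛-congˡ X = ⊛-cong {X = X} (λ _ _ → refl)

  δ-⊛ : ∀ {n} (v : Vector Carrier n) i → (δ ⊛ v) i ≈ v i
  δ-⊛ v i = sum-δ (λ j → j) v (λ j≡i → j≡i) ≡.refl

  ⊛-δ : ∀ {k l} (X : Matrix k l) i j → (X ⊛ λ h → δ h j) i ≈ X i j
  ⊛-δ X i j = begin
    sum (λ h → X i h * δ h j)  ≈⟨ sum-cong-≋ (λ h → trans (*-comm _ _) (*-congʳ (δ-sym h j))) ⟩
    sum (λ h → δ j h * X i h)  ≈⟨ δ-⊛ (X i) j ⟩
    X i j                      ∎

  -- Adjointness of a matrix and its transpose, by exchanging the two summations.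
  ∙-⊛ : ∀ {k l} (X : Matrix k l) (v : Vector Carrier k) (w : Vector Carrier l) →
        v ∙ (X ⊛ w) ≈ (X ᵀ ⊛ v) ∙ w
  ∙-⊛ {k} {l} X v w = begin
    sum (λ i → v i * sum (λ j → X i j * w j))      ≈⟨ sum-cong-≋ (λ i → *-distribˡ-sum {l} (v i) _) ⟩
    sum (λ i → sum (λ j → v i * (X i j * w j)))    ≈⟨ ∑-comm {k} {l} _ ⟩
    sum (λ j → sum (λ i → v i * (X i j * w j)))    ≈⟨ sum-cong-≋ (λ j → sum-cong-≋ λ i →
                                                        rotate (v i) (X i j) (w j)) ⟩
    sum (λ j → sum (λ i → X i j * v i * w j))      ≈⟨ sum-cong-≋ (λ j → *-distribʳ-sum {k} (w j) _) ⟨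
    sum (λ j → sum (λ i → X i j * v i) * w j)      ∎
    where
    rotate : ∀ a b d → a * (b * d) ≈ b * a * d
    rotate a b d = trans (sym (*-assoc a b d)) (*-congʳ (*-comm a b))

  -- Row `i` of the product is `Y ᵀ` applied to row `i` of `X`, so adjointness moves `Y` onto `v`.
  ⊗-⊛ : ∀ {k l m} (X : Matrix k l) (Y : Matrix l m) (v : Vector Carrier m) i →
        ((X ⊗ Y) ⊛ v) i ≈ (X ⊛ (Y ⊛ v)) i
  ⊗-⊛ X Y v i = begin
    (λ j → sum (λ h → X i h * Y h j)) ∙ v  ≈⟨ ∙-cong {w = v} (λ j → ∙-comm (X i) λ h → Y h j) (λ _ → refl) ⟩
    (Y ᵀ ⊛ X i) ∙ v                        ≈⟨ ∙-⊛ Y (X i) v ⟨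
    X i ∙ (Y ⊛ v)                          ∎

  ≋δ⇒⊛-cancel : ∀ {n} {X Y : Matrix n n} → (X ⊗ Y) ≋ δ → ∀ v i → (X ⊛ (Y ⊛ v)) i ≈ v i
  ≋δ⇒⊛-cancel {X = X} {Y} XY≋δ v i = begin
    (X ⊛ (Y ⊛ v)) i    ≈⟨ ⊗-⊛ X Y v i ⟨
    ((X ⊗ Y) ⊛ v) i    ≈⟨ ⊛-cong XY≋δ (λ _ → refl) i ⟩
    (δ ⊛ v) i          ≈⟨ δ-⊛ v i ⟩
    v i                ∎

  -- Evaluates `Z X Y` in two ways, one column of `Y` at a time.
  leftInverse≋rightInverse : ∀ {n} {X Y Z : Matrix n n} → (Z ⊗ X) ≋ δ → (X ⊗ Y) ≋ δ → Z ≋ Y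
  leftInverse≋rightInverse {X = X} {Y} {Z} ZX≋δ XY≋δ i j = begin
    Z i j                                ≈⟨ ⊛-δ Z i j ⟨
    (Z ⊛ λ h → δ h j) i                  ≈⟨ ⊛-congˡ Z (λ h → XY≋δ h j) i ⟨
    (Z ⊛ (X ⊛ λ h → Y h j)) i            ≈⟨ ≋δ⇒⊛-cancel {X = Z} ZX≋δ (λ h → Y h j) i ⟩
    Y i j                                ∎

  -- Inversion of positive definite matrices by elimination

  module Schur {n} (X : Matrix (suc n) (suc n))
    (a⁻¹ : Carrier) (a*a⁻¹≈1 : X zero zero * a⁻¹ ≈ 1#) where
    row col : Vector Carrier n
    row j = X zero (suc j)
    col i = X (suc i) zero

    complement : Matrix n n
    complement i j = X (suc i) (suc j) - col i * a⁻¹ * row j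

    -- The first entry is the first unknown as solved from the first equation with right-hand side
    -- `t`, the other unknowns being `v`.
    lift : Carrier → Vector Carrier n → Vector Carrier (suc n)
    lift t v = a⁻¹ * (t - row ∙ v) ∷ v

    ⊛-lift-zero : ∀ t v → (X ⊛ lift t v) zero ≈ t
    ⊛-lift-zero t v = begin
      X zero zero * (a⁻¹ * (t - row ∙ v)) + row ∙ v  ≈⟨ +-congʳ (*-assoc _ _ _) ⟨
      X zero zero * a⁻¹ * (t - row ∙ v) + row ∙ v    ≈⟨ +-congʳ (trans (*-congʳ a*a⁻¹≈1) (*-identityˡ _)) ⟩
      t - row ∙ v + row ∙ v                          ≈⟨ +-assoc _ _ _ ⟩
      t + (- (row ∙ v) + row ∙ v)                    ≈⟨ +-congˡ (-‿inverseˡ _) ⟩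
      t + 0#                                         ≈⟨ +-identityʳ t ⟩
      t                                              ∎

    ⊛-lift-suc : ∀ t v i → (X ⊛ lift t v) (suc i) ≈ col i * a⁻¹ * t + (complement ⊛ v) i
    ⊛-lift-suc t v i = begin
      col i * (a⁻¹ * (t - row ∙ v)) + Xv                        ≈⟨ +-congʳ (*-assoc _ _ _) ⟨
      col i * a⁻¹ * (t - row ∙ v) + Xv                          ≈⟨ +-congʳ (x[y-z]≈xy-xz _ _ _) ⟩
      col i * a⁻¹ * t - col i * a⁻¹ * (row ∙ v) + Xv            ≈⟨ +-assoc _ _ _ ⟩
      col i * a⁻¹ * t + (- (col i * a⁻¹ * (row ∙ v)) + Xv)      ≈⟨ +-congˡ (+-comm _ _) ⟩
      col i * a⁻¹ * t + (Xv - col i * a⁻¹ * (row ∙ v))          ≈⟨ +-congˡ (+-congˡ (-‿cong (*-distribˡ-sum {n} _ _))) ⟩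
      col i * a⁻¹ * t + (Xv - sum λ j → col i * a⁻¹ * (row j * v j))
        ≈⟨ +-congˡ (+-congˡ (-‿cong (sum-cong-≋ {n} λ j → *-assoc _ _ _))) ⟨
      col i * a⁻¹ * t + (Xv - (λ j → col i * a⁻¹ * row j) ∙ v)  ≈⟨ +-congˡ (∙-minusˡ _ _ v) ⟨
      col i * a⁻¹ * t + (complement ⊛ v) i                      ∎
      where
      Xv : Carrier
      Xv = (λ j → X (suc i) (suc j)) ∙ v

    -- With `t` zero, `X` sends the lift of `v` to a vector with first entry zero and remaining
    -- entries `complement ⊛ v`, so the two quadratic forms take the same value.
    complement-positiveDefinite : PositiveDefinite X → PositiveDefinite complement
    complement-positiveDefinite X>0 v (i , vi#0) =
      <-respʳ-≈ (begin
        lift 0# v ∙ (X ⊛ lift 0# v)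
          ≈⟨ +-cong (trans (*-congˡ (⊛-lift-zero 0# v)) (zeroʳ _))
                    (sum-cong-≋ λ j → *-congˡ (trans (⊛-lift-suc 0# v j)
                      (trans (+-congʳ (zeroʳ _)) (+-identityˡ _)))) ⟩
        0# + v ∙ (complement ⊛ v)  ≈⟨ +-identityˡ _ ⟩
        v ∙ (complement ⊛ v)       ∎)
        (X>0 (lift 0# v) (suc i , vi#0))

    solve : (∀ (y : Vector Carrier n) → ∃ λ u → ∀ i → (complement ⊛ u) i ≈ y i) →
            ∀ (y : Vector Carrier (suc n)) → ∃ λ u → ∀ i → (X ⊛ u) i ≈ y i
    -- The contribution of the first equation is subtracted from the other right-hand sides, leaving
    -- a system for the complement.
    solve solve′ y with solve′ (λ i → y (suc i) - col i * a⁻¹ * y zero)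
    ... | u , Su≈y = lift (y zero) u , λ where
      zero    → ⊛-lift-zero (y zero) u
      (suc i) → begin
        (X ⊛ lift (y zero) u) (suc i)                   ≈⟨ ⊛-lift-suc (y zero) u i ⟩
        col i * a⁻¹ * y zero + (complement ⊛ u) i       ≈⟨ +-congˡ (Su≈y i) ⟩
        col i * a⁻¹ * y zero + (y (suc i) - col i * a⁻¹ * y zero)
          ≈⟨ +-assoc _ _ _ ⟨
        col i * a⁻¹ * y zero + y (suc i) - col i * a⁻¹ * y zero
          ≈⟨ xyx⁻¹≈y _ _ ⟩
        y (suc i)                                       ∎

  -- Induction on the size. The corner entry is always a usable pivot, being the value of the
  -- quadratic form at the first unit vector.
  positiveDefinite⇒solvable : ∀ {n} {X : Matrix n n} → PositiveDefinite X →
                              ∀ (y : Vector Carrier n) → ∃ λ u → ∀ i → (X ⊛ u) i ≈ y i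
  positiveDefinite⇒solvable {0}     X>0 y = y , λ ()
  positiveDefinite⇒solvable {suc n} {X} X>0 =
    Schur.solve X a⁻¹ a*a⁻¹≈1
      (positiveDefinite⇒solvable (Schur.complement-positiveDefinite X a⁻¹ a*a⁻¹≈1 X>0))
    where
    e₀ : Vector Carrier (suc n)
    e₀ i = δ i zero

    pivot-#0 : X zero zero # 0#
    pivot-#0 = #-congʳ (begin
      e₀ ∙ (X ⊛ e₀)  ≈⟨ ∙-comm e₀ (X ⊛ e₀) ⟩
      -- The dot product is read as a matrix with a single row applied to `e₀`.
      (X ⊛ e₀) ∙ e₀  ≈⟨ ⊛-δ {k = 1} (λ _ → X ⊛ e₀) zero zero ⟩
      (X ⊛ e₀) zero  ≈⟨ ⊛-δ X zero zero ⟩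
      X zero zero    ∎) (>⇒# (X>0 e₀ (zero , 1#0)))

    a⁻¹ : Carrier
    a⁻¹ = proj₁ (#⇒invertible pivot-#0)

    a*a⁻¹≈1 : X zero zero * a⁻¹ ≈ 1#
    a*a⁻¹≈1 = trans (*-congʳ (sym (x-0≈x _))) (proj₂ (proj₂ (#⇒invertible pivot-#0)))

  positiveDefinite⇒rightInverse : ∀ {n} {X : Matrix n n} → PositiveDefinite X → ∃ λ Y → (X ⊗ Y) ≋ δ
  positiveDefinite⇒rightInverse {X = X} X>0 =
    (λ i j → proj₁ (solve j) i) , λ i j → proj₂ (solve j) i
    where
    solve : ∀ j → ∃ λ u → ∀ i → (X ⊛ u) i ≈ δ i j
    solve j = positiveDefinite⇒solvable X>0 λ i → δ i j

  ᵀ-positiveDefinite : ∀ {n} {X : Matrix n n} → PositiveDefinite X → PositiveDefinite (X ᵀ)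
  ᵀ-positiveDefinite {X = X} X>0 v v#0 =
    <-respʳ-≈ (trans (∙-⊛ X v v) (∙-comm (X ᵀ ⊛ v) v)) (X>0 v v#0)

  -- Elimination yields only right inverses. A right inverse of the transpose, transposed, is a left
  -- inverse of `X`, and the two must coincide.
  positiveDefinite⇒inverse : ∀ {n} {X : Matrix n n} → PositiveDefinite X → ∃ λ Y → Y IsInverseOf X
  positiveDefinite⇒inverse {X = X} X>0
    with positiveDefinite⇒rightInverse X>0 | positiveDefinite⇒rightInverse (ᵀ-positiveDefinite X>0)
  ... | Y , XY≋δ | Z , XᵀZ≋δ = Y , XY≋δ , λ i j → begin
    (Y ⊗ X) i j      ≈⟨ ∙-cong {w = λ h → X h j} (leftInverse≋rightInverse ZᵀX≋δ XY≋δ i) (λ _ → refl) ⟨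
    (Z ᵀ ⊗ X) i j    ≈⟨ ZᵀX≋δ i j ⟩
    δ i j            ∎
    where
    ZᵀX≋δ : (Z ᵀ ⊗ X) ≋ δ
    ZᵀX≋δ i j = trans (∙-comm (λ h → Z h i) (λ h → X h j)) (trans (XᵀZ≋δ j i) (δ-sym j i))

  -- Put `u = Y ⊛ v`, so that `X ⊛ u` is `v`. The form of `Y` at `v` is then the form of `X` at `u`.
  rightInverse-positiveDefinite : ∀ {n} {X Y : Matrix n n} → PositiveDefinite X → (X ⊗ Y) ≋ δ →
                                  PositiveDefinite Y
  rightInverse-positiveDefinite {X = X} {Y} X>0 XY≋δ v (i , vi#0) =
    <-respʳ-≈ (begin
      u ∙ (X ⊛ u)  ≈⟨ ∙-cong {v = u} (λ _ → refl) Xu≈v ⟩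
      u ∙ v        ≈⟨ ∙-comm u v ⟩
      v ∙ u        ∎)
      (X>0 u u#0)
    where
    u : Vector Carrier _
    u = Y ⊛ v

    Xu≈v : ∀ j → (X ⊛ u) j ≈ v j
    Xu≈v = ≋δ⇒⊛-cancel {X = X} XY≋δ v

    u#0 : Nonzero u
    -- An entry of `X ⊛ u` apart from zero has a summand apart from zero, hence a factor `u j` apart
    -- from zero.
    u#0 with sum-#0 (#-congʳ (sym (Xu≈v i)) vi#0)
    ... | j , Xu#0 = j , *-#0ʳ Xu#0

  -- By adjointness the form at `v` equals the form of `X` at `C ⊛ v`.
  congruence-positiveDefinite : ∀ {k l} {X : Matrix k k} (C : Matrix k l) → PositiveDefinite X →
    (∀ v → Nonzero v → Nonzero (C ⊛ v)) → PositiveDefinite (C ᵀ ⊗ X ⊗ C)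
  congruence-positiveDefinite {X = X} C X>0 C-injective v v#0 =
    <-respʳ-≈ (begin
      (C ⊛ v) ∙ (X ⊛ (C ⊛ v))          ≈⟨ ∙-comm (C ⊛ v) (X ⊛ (C ⊛ v)) ⟩
      (X ⊛ (C ⊛ v)) ∙ (C ⊛ v)          ≈⟨ ∙-⊛ C (X ⊛ (C ⊛ v)) v ⟩
      (C ᵀ ⊛ (X ⊛ (C ⊛ v))) ∙ v        ≈⟨ ∙-comm (C ᵀ ⊛ (X ⊛ (C ⊛ v))) v ⟩
      v ∙ (C ᵀ ⊛ (X ⊛ (C ⊛ v)))        ≈⟨ ∙-cong {v = v} (λ _ → refl) (λ i →
                                            trans (⊗-⊛ (C ᵀ ⊗ X) C v i) (⊗-⊛ (C ᵀ) X (C ⊛ v) i)) ⟨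
      v ∙ (C ᵀ ⊗ X ⊗ C ⊛ v)            ∎)
      (X>0 (C ⊛ v) (C-injective v v#0))

-- The weighted Laplacian and its energy

module Laplacian {c ℓ₁ ℓ₂} {ℝ : Reals c ℓ₁ ℓ₂} {n} (G : Network ℝ n) where
  open Reals ℝ hiding (zero)
  open Matrices ℝ
  open Network G
  open CommutativeRing commutativeRing using (ring; semiring)
  open RingProperties ring
  open SumProperties semiring using (sum-cong-≋; ∑-distrib-+; ∑-comm; *-distribˡ-sum; *-distribʳ-sum)
  open OrderedField ℝ
  open LinearAlgebra ℝ
  open ≈-Reasoning setoid

  weight-sym : ∀ u v → weight G u v ≈ weight G v u
  weight-sym u v with adj? u v | adj? v u
  ... | yes e | yes e′ = conductance-sym e e′
  ... | yes e | no ¬e′ = contradiction (symmetric e) ¬e′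
  ... | no ¬e | yes e′ = contradiction (symmetric e′) ¬e
  ... | no _  | no _   = refl

  weight-diagonal : ∀ {u v} → u ≡ v → weight G u v ≈ 0#
  weight-diagonal {u} {v} u≡v with adj? u v
  ... | yes e = contradiction e (loopless u≡v)
  ... | no _  = refl

  weight-pos : ∀ {u v} → Adj u v → 0# < weight G u v
  weight-pos {u} {v} e with adj? u v
  ... | yes e′ = conductance-pos e′
  ... | no ¬e  = contradiction e ¬e

  weight-nonneg : ∀ u v → ¬ (weight G u v < 0#)
  weight-nonneg u v with adj? u v
  ... | yes e = <-asym (conductance-pos e)
  ... | no _  = <-irrefl refl

  laplacian-sym : ∀ u v → laplacian G u v ≈ laplacian G v u
  laplacian-sym u v with u ≟ v | v ≟ u
  ... | yes u≡v | yes _   = reflexive (≡.cong (λ w → sum (weight G w)) u≡v)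
  ... | yes u≡v | no v≢u  = contradiction (≡.sym u≡v) v≢u
  ... | no u≢v  | yes v≡u = contradiction (≡.sym v≡u) u≢v
  ... | no _    | no _    = -‿cong (weight-sym u v)

  laplacian-≈ : ∀ u v → laplacian G u v ≈ δ u v * sum (weight G u) - weight G u v
  laplacian-≈ u v with u ≟ v
  ... | yes u≡v = sym (begin
    1# * sum (weight G u) - weight G u v  ≈⟨ +-cong (*-identityˡ _) (trans (-‿cong (weight-diagonal u≡v)) -0#≈0#) ⟩
    sum (weight G u) + 0#                 ≈⟨ +-identityʳ _ ⟩
    sum (weight G u)                      ∎)
  ... | no _    = sym (trans (+-congʳ (zeroˡ _)) (+-identityˡ _))

  -- The difference form of the Laplacian: it shows at once that currents ignore a common shift of
  -- the voltages.
  laplacian-⊛ : ∀ U u → (laplacian G ⊛ U) u ≈ sum λ v → weight G u v * (U u - U v)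
  laplacian-⊛ U u = begin
    laplacian G u ∙ U
      ≈⟨ ∙-cong {w = U} (laplacian-≈ u) (λ _ → refl) ⟩
    (λ v → δ u v * sum (weight G u) - weight G u v) ∙ U
      ≈⟨ ∙-minusˡ (λ v → δ u v * sum (weight G u)) (weight G u) U ⟩
    (λ v → δ u v * sum (weight G u)) ∙ U - weight G u ∙ U
      ≈⟨ +-congʳ (sum-cong-≋ {n} λ v → *-assoc _ _ _) ⟩
    (δ ⊛ λ v → sum (weight G u) * U v) u - weight G u ∙ U
      ≈⟨ +-congʳ (δ-⊛ (λ v → sum (weight G u) * U v) u) ⟩
    sum (weight G u) * U u - weight G u ∙ U
      ≈⟨ +-congʳ (*-distribʳ-sum {n} (U u) _) ⟩
    weight G u ∙ (λ _ → U u) - weight G u ∙ U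
      ≈⟨ +-cong (∙-comm (weight G u) _) (-‿cong (∙-comm (weight G u) U)) ⟩
    (λ _ → U u) ∙ weight G u - U ∙ weight G u
      ≈⟨ ∙-minusˡ (λ _ → U u) U (weight G u) ⟨
    (λ v → U u - U v) ∙ weight G u
      ≈⟨ ∙-comm (λ v → U u - U v) (weight G u) ⟩
    sum (λ v → weight G u v * (U u - U v)) ∎

  laplacian-⊛-shift : ∀ U t u → (laplacian G ⊛ λ v → U v - t) u ≈ (laplacian G ⊛ U) u
  laplacian-⊛-shift U t u = begin
    (laplacian G ⊛ λ v → U v - t) u
      ≈⟨ laplacian-⊛ (λ v → U v - t) u ⟩
    sum (λ v → weight G u v * (U u - t - (U v - t)))
      ≈⟨ sum-cong-≋ (λ v → *-congˡ ([x-z]-[y-z]≈x-y (U u) (U v) t)) ⟩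
    sum (λ v → weight G u v * (U u - U v))
      ≈⟨ laplacian-⊛ U u ⟨
    (laplacian G ⊛ U) u ∎

  laplacian-⊛-const : ∀ t u → (laplacian G ⊛ λ _ → t) u ≈ 0#
  laplacian-⊛-const t u = trans (laplacian-⊛ (λ _ → t) u)
    (sum-0 {n} λ v → trans (*-congˡ (-‿inverseʳ t)) (zeroʳ _))

  -- The Laplacian is symmetric and annihilates constants, so its image is orthogonal to the
  -- constant vector.
  sum-laplacian-⊛ : ∀ U → sum (laplacian G ⊛ U) ≈ 0#
  sum-laplacian-⊛ U = begin
    sum (laplacian G ⊛ U)                 ≈⟨ sum-cong-≋ (λ u → *-identityˡ ((laplacian G ⊛ U) u)) ⟨
    (λ _ → 1#) ∙ (laplacian G ⊛ U)        ≈⟨ ∙-⊛ (laplacian G) (λ _ → 1#) U ⟩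
    (laplacian G ᵀ ⊛ λ _ → 1#) ∙ U        ≈⟨ ∙-cong {w = U} (⊛-cong {w = λ _ → 1#} (λ u v → laplacian-sym v u)
                                               (λ _ → refl)) (λ _ → refl) ⟩
    (laplacian G ⊛ λ _ → 1#) ∙ U          ≈⟨ sum-0 (λ u → trans (*-congʳ (laplacian-⊛-const 1# u)) (zeroˡ (U u))) ⟩
    0#                                    ∎

  energy : Vector Carrier n → Carrier
  energy U = U ∙ (laplacian G ⊛ U)

  edgeEnergy : Vector Carrier n → Fin n → Fin n → Carrier
  edgeEnergy U u v = weight G u v * ((U u - U v) * (U u - U v))

  -- Each edge is counted in both directions.
  energy+energy : ∀ U → energy U + energy U ≈ sum λ u → sum λ v → edgeEnergy U u v
  energy+energy U = begin
    energy U + energy U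
      ≈⟨ +-cong energy≈ energy≈ ⟩
    sum (λ u → sum λ v → flow u v) + sum (λ u → sum λ v → flow u v)
      ≈⟨ +-congˡ (∑-comm flow) ⟩
    sum (λ u → sum λ v → flow u v) + sum (λ u → sum λ v → flow v u)
      ≈⟨ ∑-distrib-+ {n} _ _ ⟨
    sum (λ u → sum (λ v → flow u v) + sum (λ v → flow v u))
      ≈⟨ sum-cong-≋ {n} (λ u → ∑-distrib-+ {n} _ _) ⟨
    sum (λ u → sum λ v → flow u v + flow v u)
      ≈⟨ sum-cong-≋ (λ u → sum-cong-≋ λ v → symmetrise u v) ⟩
    sum (λ u → sum λ v → edgeEnergy U u v) ∎
    where
    flow : Fin n → Fin n → Carrier
    flow u v = U u * (weight G u v * (U u - U v))

    energy≈ : energy U ≈ sum λ u → sum λ v → flow u v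
    energy≈ = sum-cong-≋ λ u → trans (*-congˡ (laplacian-⊛ U u)) (*-distribˡ-sum {n} (U u) _)

    symmetrise : ∀ u v → flow u v + flow v u ≈ edgeEnergy U u v
    symmetrise u v = begin
      U u * (weight G u v * d) + U v * (weight G v u * (U v - U u))
        ≈⟨ +-congˡ (*-congˡ (*-cong (weight-sym v u) (sym (⁻¹-anti-homo‿- (U u) (U v))))) ⟩
      U u * (weight G u v * d) + U v * (weight G u v * - d)
        ≈⟨ +-congˡ (*-congˡ (-‿distribʳ-* _ _)) ⟨
      U u * (weight G u v * d) + U v * - (weight G u v * d)
        ≈⟨ +-congˡ (-‿distribʳ-* _ _) ⟨
      U u * (weight G u v * d) - U v * (weight G u v * d)
        ≈⟨ [y-z]x≈yx-zx _ _ _ ⟨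
      d * (weight G u v * d)
        ≈⟨ *-comm _ _ ⟩
      weight G u v * d * d
        ≈⟨ *-assoc _ _ _ ⟩
      weight G u v * (d * d) ∎
      where
      d : Carrier
      d = U u - U v

  #⇒edge-# : ∀ (U : Vector Carrier n) {u v} → Star Adj u v → U u # U v → ∃₂ λ a b → Adj a b × U a # U b
  #⇒edge-# U ε Uu#Uu = contradiction Uu#Uu (#-irrefl refl)
  #⇒edge-# U {u} (_◅_ {j = w} e path) Uu#Uv with #-cotrans Uu#Uv (U w)
  ... | inj₁ Uu#Uw = u , w , e , Uu#Uw
  ... | inj₂ Uw#Uv = #⇒edge-# U path Uw#Uv

  -- In the doubled energy the edge across which `U` changes contributes a positive term, and every
  -- other term is nonnegative.
  energy-pos : ∀ U {u v} → U u # U v → 0# < energy U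
  energy-pos U {u} {v} Uu#Uv with #⇒edge-# U (connected u v) Uu#Uv
  ... | a , b , e , Ua#Ub = x+x-pos⇒x-pos (<-respʳ-≈ (sym (energy+energy U))
    (sum-pos (λ w → sum-nonneg (nonneg w)) a
      (sum-pos (nonneg a) b (*-pos (weight-pos e) (square-pos (#⇒-#0 Ua#Ub))))))
    where
    nonneg : ∀ w z → ¬ (edgeEnergy U w z < 0#)
    nonneg w z = *-nonneg (weight-nonneg w z) (square-nonneg (U w - U z))

-- Grounded voltages and superport currents

module SuperportNetwork {c ℓ₁ ℓ₂} {ℝ : Reals c ℓ₁ ℓ₂} {m}
  (G : Network ℝ (suc m)) (P : Superports (suc m)) where
  open Reals ℝ hiding (zero)
  open Matrices ℝ
  open Superports P
  open CommutativeRing commutativeRing using (semiring)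
  open SumProperties semiring using (sum-cong-≋; sum-remove)
  open HeytingProperties heytingCommutativeRing
  open OrderedField ℝ
  open LinearAlgebra ℝ
  open Laplacian G
  open ≈-Reasoning setoid

  x≢root : ∀ k a → x k ≢ root a
  x≢root k = proj₂ (Equivalence.to x-lists-N (k , ≡.refl))

  x∈portOf : ∀ k → x k ∈ A (portOf k)
  x∈portOf k = proj₂ (Equivalence.to A-covers (x∈M k))

  punchIn-surjective : ∀ {w} → w ≢ g → ∃ λ i → punchIn g i ≡ w
  punchIn-surjective w≢g = punchOut (w≢g ∘ ≡.sym) , punchIn-punchOut (w≢g ∘ ≡.sym)

  -- Extension of `v` by zero at `g`, since `basis` vanishes there. Written through `basis`, it
  -- makes `D ᵀ ⊛ v` a difference of two voltages directly.
  groundedVoltage : Vector Carrier m → Vector Carrier (suc m)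
  groundedVoltage v w = basis G P w ∙ v

  groundedVoltage-punchIn : ∀ v i → groundedVoltage v (punchIn g i) ≈ v i
  groundedVoltage-punchIn v i =
    trans (∙-cong {w = v} (λ j → δ-sym (punchIn g j) (punchIn g i)) (λ _ → refl))
          (sum-δ (punchIn g) v (punchIn-injective g _ i) ≡.refl)

  groundedVoltage-ground : ∀ v → groundedVoltage v g ≈ 0#
  groundedVoltage-ground v =
    trans (∙-cong {w = v} (λ j → δ-sym (punchIn g j) g) (λ _ → refl))
          (sum-δ-∉ (punchIn g) v (λ j → punchInᵢ≢i g j ∘ ≡.sym))

  groundedVoltage-unique : ∀ U → U g ≈ 0# → ∀ w → groundedVoltage (U ∘ punchIn g) w ≈ U w
  groundedVoltage-unique U Ug≈0 w with w ≟ g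
  ... | yes ≡.refl = trans (groundedVoltage-ground (U ∘ punchIn g)) (sym Ug≈0)
  ... | no w≢g with punchIn-surjective w≢g
  ...   | i , ≡.refl = groundedVoltage-punchIn (U ∘ punchIn g) i

  incomingCurrent-grounded : ∀ U → U g ≈ 0# → ∀ i →
    incomingCurrent G P U (punchIn g i) ≈ (K G P ⊛ (U ∘ punchIn g)) i
  incomingCurrent-grounded U Ug≈0 i = begin
    laplacian G (punchIn g i) ∙ U
      ≈⟨ sum-remove {i = g} (λ w → laplacian G (punchIn g i) w * U w) ⟩
    laplacian G (punchIn g i) g * U g + (K G P ⊛ (U ∘ punchIn g)) i
      ≈⟨ +-congʳ (trans (*-congˡ Ug≈0) (zeroʳ _)) ⟩
    0# + (K G P ⊛ (U ∘ punchIn g)) i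
      ≈⟨ +-identityˡ _ ⟩
    (K G P ⊛ (U ∘ punchIn g)) i ∎

  incomingCurrent-groundedVoltage : ∀ v i →
    incomingCurrent G P (groundedVoltage v) (punchIn g i) ≈ (K G P ⊛ v) i
  incomingCurrent-groundedVoltage v i =
    trans (incomingCurrent-grounded (groundedVoltage v) (groundedVoltage-ground v) i)
          (⊛-congˡ (K G P) (groundedVoltage-punchIn v) i)

  K-positiveDefinite : PositiveDefinite (K G P)
  K-positiveDefinite v (i , vi#0) = <-respʳ-≈ (begin
    energy U
      ≈⟨ sum-remove {i = g} (λ w → U w * incomingCurrent G P U w) ⟩
    U g * incomingCurrent G P U g + (U ∘ punchIn g) ∙ (incomingCurrent G P U ∘ punchIn g)
      ≈⟨ +-cong (trans (*-congʳ (groundedVoltage-ground v)) (zeroˡ _))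
                (∙-cong (groundedVoltage-punchIn v) (incomingCurrent-groundedVoltage v)) ⟩
    0# + v ∙ (K G P ⊛ v)
      ≈⟨ +-identityˡ _ ⟩
    v ∙ (K G P ⊛ v) ∎)
    -- The voltage is zero at `g` and apart from zero at the vertex of the chosen entry.
    (energy-pos U {punchIn g i} {g}
      (#-congʳ (sym (groundedVoltage-punchIn v i)) (#-congˡ (sym (groundedVoltage-ground v)) vi#0)))
    where
    U : Vector Carrier (suc m)
    U = groundedVoltage v

  -- D with the row of g restored: D i = D⁺ (punchIn g i).
  D⁺ : Matrix (suc m) q
  D⁺ w k = δ w (x k) - δ w (rootOf k)

  D⁺-⊛ : ∀ j w → (D⁺ ⊛ j) w ≈ sum (λ k → δ w (x k) * j k) - sum (λ k → δ w (rootOf k) * j k)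
  D⁺-⊛ j w = ∙-minusˡ (λ k → δ w (x k)) (λ k → δ w (rootOf k)) j

  -- The rows of `D⁺` at the listed vertices form an identity matrix: `x` is injective and never
  -- hits a root.
  D⁺-⊛-x : ∀ j k → (D⁺ ⊛ j) (x k) ≈ j k
  D⁺-⊛-x j k = begin
    (D⁺ ⊛ j) (x k)  ≈⟨ D⁺-⊛ j (x k) ⟩
    sum (λ l → δ (x k) (x l) * j l) - sum (λ l → δ (x k) (rootOf l) * j l)
      ≈⟨ +-cong (sum-δ x j x-injective ≡.refl) (-‿cong (sum-δ-∉ rootOf j (λ l → x≢root k (portOf l)))) ⟩
    j k - 0#  ≈⟨ x-0≈x (j k) ⟩
    j k       ∎

  root∈M : ∀ a → root a ∈ M
  root∈M a = Equivalence.from A-covers (a , root∈A a)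

  D⁺-⊛-interior : ∀ j w → ¬ (w ∈ M) → (D⁺ ⊛ j) w ≈ 0#
  D⁺-⊛-interior j w w∉M = begin
    (D⁺ ⊛ j) w  ≈⟨ D⁺-⊛ j w ⟩
    sum (λ k → δ w (x k) * j k) - sum (λ k → δ w (rootOf k) * j k)
      ≈⟨ +-cong (sum-δ-∉ x {w} j (λ { k ≡.refl → w∉M (x∈M k) }))
                (-‿cong (sum-δ-∉ rootOf {w} j (λ { k ≡.refl → w∉M (root∈M (portOf k)) }))) ⟩
    0# - 0#  ≈⟨ -‿inverseʳ 0# ⟩
    0#       ∎

  -- The columns of D⁺ are differences of two vertices of the same superport.
  ∙-D⁺-⊛ : ∀ χ j → (∀ k → χ (x k) ≈ χ (rootOf k)) → χ ∙ (D⁺ ⊛ j) ≈ 0#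
  ∙-D⁺-⊛ χ j χ-constant = begin
    χ ∙ (D⁺ ⊛ j)      ≈⟨ ∙-⊛ D⁺ χ j ⟩
    (D⁺ ᵀ ⊛ χ) ∙ j    ≈⟨ sum-0 {q} (λ k → trans (*-congʳ (column k)) (zeroˡ (j k))) ⟩
    0#                ∎
    where
    evaluate : ∀ w → (λ v → δ v w) ∙ χ ≈ χ w
    evaluate w = trans (∙-cong {w = χ} (λ v → δ-sym v w) (λ _ → refl)) (δ-⊛ χ w)

    column : ∀ k → (D⁺ ᵀ ⊛ χ) k ≈ 0#
    column k = begin
      (λ w → D⁺ w k) ∙ χ  ≈⟨ ∙-minusˡ (λ w → δ w (x k)) (λ w → δ w (rootOf k)) χ ⟩
      (λ w → δ w (x k)) ∙ χ - (λ w → δ w (rootOf k)) ∙ χ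
        ≈⟨ +-cong (trans (evaluate (x k)) (χ-constant k)) (-‿cong (evaluate (rootOf k))) ⟩
      χ (rootOf k) - χ (rootOf k)  ≈⟨ -‿inverseʳ _ ⟩
      0#                           ∎

  sum-D⁺-⊛ : ∀ j → sum (D⁺ ⊛ j) ≈ 0#
  sum-D⁺-⊛ j = trans (sum-cong-≋ {suc m} (λ w → sym (*-identityˡ ((D⁺ ⊛ j) w))))
                     (∙-D⁺-⊛ (λ _ → 1#) j (λ _ → refl))

  restrict-∈ : ∀ {S : Subset (suc m)} f {w} → w ∈ S → restrict S f w ≈ f w
  restrict-∈ {S} f {w} w∈S with w ∈? S
  ... | yes _  = refl
  ... | no w∉S = contradiction w∈S w∉S

  restrict-∉ : ∀ {S : Subset (suc m)} f {w} → ¬ (w ∈ S) → restrict S f w ≈ 0#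
  restrict-∉ {S} f {w} w∉S with w ∈? S
  ... | yes w∈S = contradiction w∈S w∉S
  ... | no _    = refl

  restrict-≈ : ∀ (S : Subset (suc m)) f w → restrict S f w ≈ restrict S (λ _ → 1#) w * f w
  restrict-≈ S f w with w ∈? S
  ... | yes _ = sym (*-identityˡ (f w))
  ... | no _  = sym (zeroˡ (f w))

  -- The sum over a superport is a pairing with its indicator `χ`. Disjointness puts each `x k` and
  -- its root on the same side of `A a`, so every column pairs to zero.
  D⁺-⊛-port : ∀ j a → sumOver (A a) (D⁺ ⊛ j) ≈ 0#
  D⁺-⊛-port j a = trans (sum-cong-≋ {suc m} (restrict-≈ (A a) (D⁺ ⊛ j))) (∙-D⁺-⊛ χ j χ-constant)
    where
    χ : Vector Carrier (suc m)
    χ = restrict (A a) (λ _ → 1#)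

    χ-constant : ∀ k → χ (x k) ≈ χ (rootOf k)
    χ-constant k with x k ∈? A a
    ... | yes x∈A = sym (restrict-∈ (λ _ → 1#)
      (≡.subst (λ b → rootOf k ∈ A b) (A-disjoint (x∈portOf k) x∈A) (root∈A (portOf k))))
    ... | no x∉A  = sym (restrict-∉ (λ _ → 1#) λ r∈A → x∉A
      (≡.subst (λ b → x k ∈ A b) (A-disjoint (root∈A (portOf k)) r∈A) (x∈portOf k)))

  -- The current conditions of `Admissible`, freed from voltages so that they apply to `D⁺ ⊛ j` as
  -- well.
  record IsPortCurrent (ι : Vector Carrier (suc m)) : Set ℓ₁ where
    field
      interior : ∀ v → ¬ (v ∈ M) → ι v ≈ 0#
      port     : ∀ a → sumOver (A a) ι ≈ 0#

  D⁺-⊛-isPortCurrent : ∀ j → IsPortCurrent (D⁺ ⊛ j)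
  D⁺-⊛-isPortCurrent j = record { interior = D⁺-⊛-interior j ; port = D⁺-⊛-port j }

  -- Currents vanish in the interior and agree on `N` by assumption. Each superport has just one
  -- further vertex, its root, whose current is fixed by the zero total.
  portCurrent-unique : ∀ {ι κ} → IsPortCurrent ι → IsPortCurrent κ →
                       (∀ k → ι (x k) ≈ κ (x k)) → ∀ w → ι w ≈ κ w
  portCurrent-unique {ι} {κ} ι-port κ-port agree w with w ∈? M
  ... | no w∉M = trans (ι.interior w w∉M) (sym (κ.interior w w∉M))
    where
    module ι = IsPortCurrent ι-port
    module κ = IsPortCurrent κ-port
  ... | yes w∈M with any? (λ a → w ≟ root a)
  ...   | no w∉R with Equivalence.from x-lists-N (w∈M , λ a w≡r → w∉R (a , w≡r))
  ...     | k , ≡.refl = agree k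
  portCurrent-unique {ι} {κ} ι-port κ-port agree w | yes _ | yes (a , ≡.refl) = begin
    ι (root a)                    ≈⟨ restrict-∈ ι (root∈A a) ⟨
    restrict (A a) ι (root a)     ≈⟨ sum-determines (root a) agree-off-root
                                       (trans (IsPortCurrent.port ι-port a) (sym (IsPortCurrent.port κ-port a))) ⟩
    restrict (A a) κ (root a)     ≈⟨ restrict-∈ κ (root∈A a) ⟩
    κ (root a)                    ∎
    where
    agree-off-root : ∀ v → v ≢ root a → restrict (A a) ι v ≈ restrict (A a) κ v
    agree-off-root v v≢r with v ∈? A a
    ... | no _    = refl
    ... | yes v∈A with Equivalence.from x-lists-N
                         ( Equivalence.from A-covers (a , v∈A)
                         -- If `v` were the root of superport `b`, disjointness would give `b = a`,
                         -- making `v` the excluded root.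
                         , λ { b ≡.refl → v≢r (≡.cong root (A-disjoint (root∈A b) v∈A)) })
    ...   | k , ≡.refl = agree k

  D-⊛-nonzero : ∀ z → Nonzero z → Nonzero (D G P ⊛ z)
  D-⊛-nonzero z (k , zk#0) with punchIn-surjective (x≢root k groundPort)
  ... | i , pᵢ≡xₖ = i , #-congʳ (begin
    z k                       ≈⟨ D⁺-⊛-x z k ⟨
    (D⁺ ⊛ z) (x k)            ≡⟨ ≡.cong (D⁺ ⊛ z) pᵢ≡xₖ ⟨
    (D⁺ ⊛ z) (punchIn g i)    ∎) zk#0

  Dᵀ-⊛ : ∀ v k → (D G P ᵀ ⊛ v) k ≈ groundedVoltage v (x k) - groundedVoltage v (rootOf k)
  Dᵀ-⊛ v k = ∙-minusˡ (basis G P (x k)) (basis G P (rootOf k)) v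

  K-inverse : ∃ λ K⁻¹ → K⁻¹ IsInverseOf K G P
  K-inverse = positiveDefinite⇒inverse K-positiveDefinite

  -- The impedance matrix and the superport response

  module Response (K⁻¹ : Matrix m m) (K⁻¹-inverse : K⁻¹ IsInverseOf K G P) where
    KK⁻¹≋δ : (K G P ⊗ K⁻¹) ≋ δ
    KK⁻¹≋δ = proj₁ K⁻¹-inverse

    K⁻¹K≋δ : (K⁻¹ ⊗ K G P) ≋ δ
    K⁻¹K≋δ = proj₂ K⁻¹-inverse

    impedance : Matrix q q
    impedance = D G P ᵀ ⊗ K⁻¹ ⊗ D G P

    impedance-⊛ : ∀ j k → (impedance ⊛ j) k ≈ (D G P ᵀ ⊛ (K⁻¹ ⊛ (D G P ⊛ j))) k
    impedance-⊛ j k =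
      trans (⊗-⊛ (D G P ᵀ ⊗ K⁻¹) (D G P) j k) (⊗-⊛ (D G P ᵀ) K⁻¹ (D G P ⊛ j) k)

    impedance-positiveDefinite : PositiveDefinite impedance
    impedance-positiveDefinite = congruence-positiveDefinite (D G P)
      (rightInverse-positiveDefinite K-positiveDefinite KK⁻¹≋δ) D-⊛-nonzero

    admissible⇒impedance-⊛ : ∀ {y U} → Admissible G P y U →
      ∀ k → (impedance ⊛ (incomingCurrent G P U ∘ x)) k ≈ y k
    admissible⇒impedance-⊛ {y} {U} adm k = begin
      (impedance ⊛ j) k                                      ≈⟨ impedance-⊛ j k ⟩
      (D G P ᵀ ⊛ (K⁻¹ ⊛ (D G P ⊛ j))) k                      ≈⟨ ⊛-congˡ (D G P ᵀ) (⊛-congˡ K⁻¹ Kv≈Dj) k ⟨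
      (D G P ᵀ ⊛ (K⁻¹ ⊛ (K G P ⊛ v))) k                      ≈⟨ ⊛-congˡ (D G P ᵀ)
                                                                   (≋δ⇒⊛-cancel {X = K⁻¹} K⁻¹K≋δ v) k ⟩
      (D G P ᵀ ⊛ v) k                                        ≈⟨ Dᵀ-⊛ v k ⟩
      groundedVoltage v (x k) - groundedVoltage v (rootOf k) ≈⟨ +-cong (voltage (x k)) (-‿cong (voltage (rootOf k))) ⟩
      U (x k) - U g - (U (rootOf k) - U g)                   ≈⟨ [x-z]-[y-z]≈x-y (U (x k)) (U (rootOf k)) (U g) ⟩
      U (x k) - U (rootOf k)                                 ≈⟨ portVoltage k ⟩
      y k                                                    ∎
      where
      open Admissible adm

      j : Vector Carrier q
      j = incomingCurrent G P U ∘ x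

      U₀ : Vector Carrier (suc m)
      -- Shifting to zero at `g` preserves currents and port voltages, and lets `K` replace the full
      -- Laplacian.
      U₀ w = U w - U g

      v : Vector Carrier m
      v = U₀ ∘ punchIn g

      voltage : ∀ w → groundedVoltage v w ≈ U w - U g
      voltage = groundedVoltage-unique U₀ (-‿inverseʳ (U g))

      Kv≈Dj : ∀ i → (K G P ⊛ v) i ≈ (D G P ⊛ j) i
      Kv≈Dj i = begin
        (K G P ⊛ v) i                        ≈⟨ incomingCurrent-grounded U₀ (-‿inverseʳ (U g)) i ⟨
        incomingCurrent G P U₀ (punchIn g i) ≈⟨ laplacian-⊛-shift U (U g) (punchIn g i) ⟩
        incomingCurrent G P U (punchIn g i)
          ≈⟨ portCurrent-unique (record { interior = interiorCurrent ; port = portCurrent })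
               (D⁺-⊛-isPortCurrent j) (λ l → sym (D⁺-⊛-x j l)) (punchIn g i) ⟩
        (D G P ⊛ j) i                        ∎

    -- The witness runs the forward computation backwards: currents `L₀ ⊛ y` at `N`, then grounded
    -- voltages solving `K v = D j`.
    inverse⇒admissible : ∀ {L₀} → L₀ IsInverseOf impedance → ∀ y →
      Admissible G P y (groundedVoltage (K⁻¹ ⊛ (D G P ⊛ (L₀ ⊛ y))))
    inverse⇒admissible {L₀} (BL₀≋δ , _) y = record
      { portVoltage     = λ k → begin
          U (x k) - U (rootOf k)      ≈⟨ Dᵀ-⊛ v k ⟨
          (D G P ᵀ ⊛ v) k             ≈⟨ impedance-⊛ j k ⟨
          (impedance ⊛ (L₀ ⊛ y)) k    ≈⟨ ≋δ⇒⊛-cancel {X = impedance} BL₀≋δ y k ⟩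
          y k                         ∎
      ; interiorCurrent = λ w w∉M → trans (current w) (D⁺-⊛-interior j w w∉M)
      ; portCurrent     = λ a → trans (sum-cong-≋ {suc m} (restrict-current a)) (D⁺-⊛-port j a)
      }
      where
      j : Vector Carrier q
      j = L₀ ⊛ y

      v : Vector Carrier m
      v = K⁻¹ ⊛ (D G P ⊛ j)

      U : Vector Carrier (suc m)
      U = groundedVoltage v

      current-off-ground : ∀ w → w ≢ g → incomingCurrent G P U w ≈ (D⁺ ⊛ j) w
      current-off-ground w w≢g with punchIn-surjective w≢g
      ... | i , ≡.refl = trans (incomingCurrent-groundedVoltage v i)
                               (≋δ⇒⊛-cancel {X = K G P} KK⁻¹≋δ (D G P ⊛ j) i)

      current : ∀ w → incomingCurrent G P U w ≈ (D⁺ ⊛ j) w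
      current w with w ≟ g
      ... | no w≢g     = current-off-ground w w≢g
      -- The equation `K v = D j` has no row at `g`. Both current vectors have total zero, so
      -- agreement elsewhere forces agreement there.
      ... | yes ≡.refl = sum-determines g current-off-ground
                           (trans (sum-laplacian-⊛ U) (sym (sum-D⁺-⊛ j)))

      restrict-current : ∀ a w → restrict (A a) (incomingCurrent G P U) w ≈ restrict (A a) (D⁺ ⊛ j) w
      restrict-current a w with w ∈? A a
      ... | yes _ = current w
      ... | no _  = refl

    inverse⇒response : ∀ {L₀} → L₀ IsInverseOf impedance → IsResponseMatrix G P L₀
    inverse⇒response {L₀} inverse y =
      (_ , inverse⇒admissible inverse y) , λ U adm k → begin
        incomingCurrent G P U (x k)
          ≈⟨ ≋δ⇒⊛-cancel {X = L₀} (proj₂ inverse) (incomingCurrent G P U ∘ x) k ⟨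
        (L₀ ⊛ (impedance ⊛ (incomingCurrent G P U ∘ x))) k
          ≈⟨ ⊛-congˡ L₀ (admissible⇒impedance-⊛ adm) k ⟩
        (L₀ ⊛ y) k ∎

    -- For each unit vector some admissible voltages exist, and both matrices must give the currents
    -- they induce.
    response-unique : ∀ {L L′} → IsResponseMatrix G P L → IsResponseMatrix G P L′ → L ≋ L′
    response-unique {L} {L′} L-response L′-response k l with L-response (λ h → δ h l)
    ... | (U , adm) , L-current = begin
      L k l                          ≈⟨ ⊛-δ L k l ⟨
      (L ⊛ λ h → δ h l) k            ≈⟨ L-current U adm k ⟨
      incomingCurrent G P U (x k)    ≈⟨ proj₂ (L′-response λ h → δ h l) U adm k ⟩
      (L′ ⊛ λ h → δ h l) k           ≈⟨ ⊛-δ L′ k l ⟩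
      L′ k l                         ∎

    impedance-inverse : ∃ λ L₀ → L₀ IsInverseOf impedance
    impedance-inverse = positiveDefinite⇒inverse impedance-positiveDefinite

    -- The inverse of `impedance` is itself a response matrix, so uniqueness identifies `L` with it.
    response⇒inverse : ∀ {L} → IsResponseMatrix G P L → L IsInverseOf impedance
    response⇒inverse {L} L-response =
      (λ i j → trans (⊛-congˡ impedance (λ h → L≋L₀ h j) i) (proj₁ L₀-inverse i j)) ,
      (λ i j → trans (∙-cong {w = λ h → impedance h j} (L≋L₀ i) (λ _ → refl)) (proj₂ L₀-inverse i j))
      where
      L₀ : Matrix q q
      L₀ = proj₁ impedance-inverse

      L₀-inverse : L₀ IsInverseOf impedance
      L₀-inverse = proj₂ impedance-inverse

      L≋L₀ : L ≋ L₀
      L≋L₀ = response-unique L-response (inverse⇒response L₀-inverse)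

proposition2p2 : ∀ {c ℓ₁ ℓ₂} (ℝ : Reals c ℓ₁ ℓ₂) {m : ℕ}
    (G : Network ℝ (suc m)) (P : Superports (suc m)) →
    let open Matrices ℝ in
    ∃ λ (K⁻¹ : Matrix m m) →
    K⁻¹ IsInverseOf K G P ×
    (∃ λ L → IsResponseMatrix G P L) ×
    (∀ L → IsResponseMatrix G P L →
    L IsInverseOf (D G P ᵀ ⊗ K⁻¹ ⊗ D G P))
proposition2p2 ℝ G P =
  proj₁ K-inverse ,
  proj₂ K-inverse ,
  (proj₁ impedance-inverse , inverse⇒response (proj₂ impedance-inverse)) ,
  (λ _ → response⇒inverse)
  where
  open SuperportNetwork G P
  open Response (proj₁ K-inverse) (proj₂ K-inverse)
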